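{- Let $v\ge2$. An optimum $(d,2)$-CDA$((d+1)v^2;5,v)$ exists for every positive integer $d$ with $d+1\le v$, except possibly in the following cases: (1) $(d,v)\in\{(2,6),(4,6)\}$; (2) $v=6u$ and $d=v-2$, where $u\ne1$ and $\gcd(u,6)=1$.
   Context: Consecutive $t$-way interaction in an $N\times k$ array $A=(a_{ij})$ over a $v$-set $V$: $T=\{(i,x_i),\dots,(i+t-1,x_{i+t-1})\}$, $1\le i\le k-t+1$, $x_r\in V$; $\rho(A,T)=\{r: a_{r,j}=x_j\ \forall (j,x_j)\in T\}$, $\rho(A,\mathcal T)=\bigcup_{T\in\mathcal T}\rho(A,T)$. A $(d,t)$-CDA$(N;k,v)$ is an $N\times k$ array over $V$ in which every $t$ consecutive columns contain every $t$-tuple at least once, and such that for every set $\mathcal T$ of exactly $d$ distinct consecutive $t$-way interactions and every consecutive $t$-way interaction $T$: $\rho(A,T)\subseteq\rho(A,\mathcal T)$ iff $T\in\mathcal T$. It is optimum if $N=(d+1)v^t$. -}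

module Defs where

open import Data.Fin.Base using (Fin; toℕ; fromℕ<)
open import Data.Fin.Properties using (toℕ<n)
open import Data.List.Base using (List; length)
open import Data.List.Membership.Propositional renaming (_∈_ to _∈ˡ_)
open import Data.List.Relation.Unary.Any using (Any)
open import Data.List.Relation.Unary.Unique.Propositional using (Unique)
open import Data.Nat.Base using (ℕ; _+_; _*_; _^_; _≤_)
open import Data.Nat.GCD using (gcd)
open import Data.Nat.Properties using (<-≤-trans; +-monoʳ-<)
open import Data.Product.Base using (_×_; ∃-syntax)
open import Data.Sum.Base using (_⊎_)
open import Data.Vec.Base using (Vec; lookup)
open import Function.Bundles using (_⇔_)
open import Level using (0ℓ)
open import Relation.Binary.PropositionalEquality using (_≡_; _≢_)
open import Relation.Unary using (Pred; _∈_; _⊆_)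

Array : ℕ → ℕ → ℕ → Set
Array N k v = Fin N → Fin k → Fin v

-- {(i , x₀) , … , (i + t − 1 , xₜ₋₁)}, with columns numbered from 0.  The bound
-- is irrelevant, so _≡_ compares only i and the x's, i.e. (for t ≥ 1) compares
-- interactions as sets of pairs.
record Interaction (t k v : ℕ) : Set where
  constructor interaction
  field
    start   : ℕ
    .bound  : start + t ≤ k
    values  : Vec (Fin v) t

open Interaction public using (start; values)

column : ∀ {t k v} → Interaction t k v → Fin t → Fin k
column (interaction i i+t≤k _) j =
  fromℕ< (<-≤-trans (+-monoʳ-< i (toℕ<n j)) i+t≤k)

ρ : ∀ {N t k v} → Array N k v → Interaction t k v → Pred (Fin N) 0ℓ
ρ A T r = ∀ j → A r (column T j) ≡ lookup (values T) j

ρ⋃ : ∀ {N t k v} → Array N k v → List (Interaction t k v) → Pred (Fin N) 0ℓ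
ρ⋃ A 𝒯 r = Any (λ T → r ∈ ρ A T) 𝒯

-- A set of exactly d interactions is a duplicate-free list of length d.
record IsCDA (d t : ℕ) {N k v : ℕ} (A : Array N k v) : Set where
  field
    covering  : (T : Interaction t k v) → ∃[ r ] r ∈ ρ A T
    detecting : (𝒯 : List (Interaction t k v)) → Unique 𝒯 → length 𝒯 ≡ d →
                (T : Interaction t k v) → (ρ A T ⊆ ρ⋃ A 𝒯) ⇔ (T ∈ˡ 𝒯)

record IsOptimumCDA (d t : ℕ) {N k v : ℕ} (A : Array N k v) : Set where
  field
    isCDA   : IsCDA d t A
    optimum : N ≡ (d + 1) * v ^ t

PossibleException : ℕ → ℕ → Set
PossibleException d v =
    (d ≡ 2 × v ≡ 6)
  ⊎ (d ≡ 4 × v ≡ 6)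
  ⊎ (∃[ u ] v ≡ 6 * u × d + 2 ≡ v × u ≢ 1 × gcd u 6 ≡ 1)

{-# OPTIONS --safe #-}

-- Index the rows by (s , a , b) with a , b ∈ ℤ/v and s running over d + 1
-- residues, and let the row (s , a , b) be (a , b , a + s , b + s , a).  For each
-- s the map (a , b) ↦ (any two consecutive entries) is bijective, so every
-- interaction lies in d + 1 rows with distinct s.  Two interactions with
-- different starts together involve both a and a + s, or both b and b + s, so
-- they share rows of at most one s.  Hence d interactions cover at most d of
-- the d + 1 rows of a further one.
module Submission where

open import Data.Empty using (⊥-elim-irr)
open import Data.Fin.Base using (Fin; zero; toℕ; inject≤; combine; remQuot)
open import Data.Fin.Patterns using (0F; 1F; 2F; 3F; 4F)
open import Data.Fin.Properties using (toℕ<n; toℕ-fromℕ<; toℕ-injective; inject≤-injective; remQuot-combine; pigeonhole; <⇒≢) renaming (_≟_ to _≟ᶠ_)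
open import Data.List.Base using (List; length; lookup)
open import Data.List.Membership.Propositional using () renaming (_∈_ to _∈ˡ_)
open import Data.List.Membership.Propositional.Properties using (∈-lookup)
open import Data.List.Relation.Unary.Any using (index; any?) renaming (map to mapᴬ)
open import Data.List.Relation.Unary.Any.Properties using (lookup-index)
open import Data.Nat.Base using (ℕ; suc; _+_; _*_; _∸_; _^_; _≤_; _<_; s≤s; z≤n; NonZero; >-nonZero)
open import Data.Nat.DivMod using (_%_; _mod_; m%n<n; m%n%n≡m%n; [m+n]%n≡m%n; m<n⇒m%n≡m; %-distribˡ-+)
open import Data.Nat.Properties using (+-comm; +-assoc; m<m+n; m+[n∸m]≡n; m∸n+n≡m; <⇒≤; ≤-trans; <-cmp; _≟_)
open import Data.Product.Base using (Σ-syntax; _×_; _,_; proj₁; map₂)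
open import Data.Vec.Base using ([]; _∷_; tabulate) renaming (lookup to lookupᵛ)
open import Data.Vec.Properties using (tabulate∘lookup; tabulate-cong; ≡-dec)
open import Function.Base using (case_of_)
open import Function.Bundles using (mk⇔)
open import Relation.Binary.Definitions using (DecidableEquality; tri<; tri≈; tri>)
open import Relation.Binary.PropositionalEquality using (_≡_; _≢_; refl; sym; trans; cong; subst; module ≡-Reasoning)
open import Relation.Nullary.Decidable.Core using (yes; no)
open import Relation.Nullary.Negation.Core using (¬_; contradiction)
open import Relation.Unary using (_∈_)
open import Defs

module _ {t k v : ℕ} where

  ≡-interaction : {T T′ : Interaction t k v} →
    start T ≡ start T′ → values T ≡ values T′ → T ≡ T′
  ≡-interaction {interaction _ _ _} {interaction _ _ _} refl refl = refl

  -- Makes membership in a list of interactions decidable, which lets `detect` argue by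
  -- contradiction.
  _≟ᴵ_ : DecidableEquality (Interaction t k v)
  T ≟ᴵ T′ with start T ≟ start T′ | ≡-dec _≟ᶠ_ (values T) (values T′)
  ... | yes p | yes q = yes (≡-interaction p q)
  ... | no ¬p | _     = no λ { refl → ¬p refl }
  ... | yes _ | no ¬q = no λ { refl → ¬q refl }

  -- A common row `r` forces both value vectors to be the entries of `r` in the same `t` columns.
  ρ-start-determines : ∀ {N} (A : Array N k v) (T T′ : Interaction t k v) {r} →
    start T ≡ start T′ → r ∈ ρ A T → r ∈ ρ A T′ → T ≡ T′
  ρ-start-determines A (interaction i _ xs) (interaction _ _ ys) refl r∈T r∈T′ =
    ≡-interaction refl (begin
      xs                        ≡⟨ tabulate∘lookup xs ⟨
      tabulate (lookupᵛ xs)     ≡⟨ tabulate-cong (λ j → trans (sym (r∈T j)) (r∈T′ j)) ⟩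
      tabulate (lookupᵛ ys)     ≡⟨ tabulate∘lookup ys ⟩
      ys                        ∎)
    where open ≡-Reasoning

  -- Reduces detection by `d`-sets to a condition on pairs: an interaction other than `T` contains
  -- at most one of the `d + 1` rows `row T s`, so `d` of them miss at least one.
  separated⇒IsCDA : ∀ {N d} (A : Array N k v)
    (row : Interaction t k v → Fin (d + 1) → Fin N) →
    (∀ T s → row T s ∈ ρ A T) →
    (∀ T T′ s s′ → T ≢ T′ → row T s ∈ ρ A T′ → row T s′ ∈ ρ A T′ → s ≡ s′) →
    IsCDA d t A
  separated⇒IsCDA {N} {d} A row row∈ρ separated = record
    { covering  = λ T → row T last , row∈ρ T last
    ; detecting = λ 𝒯 _ ∣𝒯∣≡d T →
        mk⇔ (detect 𝒯 ∣𝒯∣≡d T) (λ T∈𝒯 r∈T → mapᴬ (λ { refl → r∈T }) T∈𝒯)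
    }
    where
    -- Any index serves for covering. Since `d + 1` does not compute to a successor, `zero` is
    -- transported from `Fin (1 + d)`.
    last : Fin (d + 1)
    last = subst Fin (+-comm 1 d) zero

    detect : (𝒯 : List (Interaction t k v)) → length 𝒯 ≡ d → ∀ T →
      (∀ {r} → r ∈ ρ A T → r ∈ ρ⋃ A 𝒯) → T ∈ˡ 𝒯
    detect 𝒯 refl T ρT⊆ρ⋃𝒯 with any? (T ≟ᴵ_) 𝒯
    ... | yes T∈𝒯 = T∈𝒯
    -- Send each `s` to the position in `𝒯` of a member containing `row T s`. There are `d + 1`
    -- indices and only `d` positions, so some member, distinct from `T`, contains two of these
    -- rows.
    ... | no  T∉𝒯 with pigeonhole (m<m+n d (s≤s z≤n)) (λ s → index (ρT⊆ρ⋃𝒯 (row∈ρ T s)))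
    ...   | s , s′ , s<s′ , same = contradiction
              (separated T (lookup 𝒯 i) s s′ T≢Tᵢ (lookup-index (ρT⊆ρ⋃𝒯 (row∈ρ T s)))
                (subst (λ j → row T s′ ∈ ρ A (lookup 𝒯 j)) (sym same)
                  (lookup-index (ρT⊆ρ⋃𝒯 (row∈ρ T s′)))))
              (<⇒≢ s<s′)
      where
      i = index (ρT⊆ρ⋃𝒯 (row∈ρ T s))
      T≢Tᵢ : T ≢ lookup 𝒯 i
      T≢Tᵢ T≡Tᵢ = T∉𝒯 (subst (_∈ˡ 𝒯) (sym T≡Tᵢ) (∈-lookup i))

module _ {v : ℕ} .{{_ : NonZero v}} where

  infixl 6 _⊹_ _⊕_ _⊖_

  -- The shift is a natural number because subtracting `y` means adding `v ∸ toℕ y`, which equals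
  -- `v` when `y` is zero and so lies outside `Fin v`.
  _⊹_ : Fin v → ℕ → Fin v
  x ⊹ m = (toℕ x + m) mod v

  ⊹-inverse : ∀ x {m n} → m + n ≡ v → x ⊹ m ⊹ n ≡ x
  ⊹-inverse x {m} {n} m+n≡v = toℕ-injective (begin
    toℕ (x ⊹ m ⊹ n)                   ≡⟨ toℕ-fromℕ< (m%n<n (toℕ (x ⊹ m) + n) v) ⟩
    (toℕ (x ⊹ m) + n) % v             ≡⟨ cong (λ y → (y + n) % v) (toℕ-fromℕ< (m%n<n (toℕ x + m) v)) ⟩
    ((toℕ x + m) % v + n) % v         ≡⟨ %-distribˡ-+ ((toℕ x + m) % v) n v ⟩
    ((toℕ x + m) % v % v + n % v) % v ≡⟨ cong (λ y → (y + n % v) % v) (m%n%n≡m%n (toℕ x + m) v) ⟩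
    ((toℕ x + m) % v + n % v) % v     ≡⟨ %-distribˡ-+ (toℕ x + m) n v ⟨
    (toℕ x + m + n) % v               ≡⟨ cong (_% v) (+-assoc (toℕ x) m n) ⟩
    (toℕ x + (m + n)) % v             ≡⟨ cong (λ y → (toℕ x + y) % v) m+n≡v ⟩
    (toℕ x + v) % v                   ≡⟨ [m+n]%n≡m%n (toℕ x) v ⟩
    toℕ x % v                         ≡⟨ m<n⇒m%n≡m (toℕ<n x) ⟩
    toℕ x                             ∎)
    where open ≡-Reasoning

  _⊕_ _⊖_ : Fin v → Fin v → Fin v
  x ⊕ y = x ⊹ toℕ y
  x ⊖ y = x ⊹ (v ∸ toℕ y)

  x⊖y⊕y≡x : ∀ x y → x ⊖ y ⊕ y ≡ x
  x⊖y⊕y≡x x y = ⊹-inverse x (m∸n+n≡m (<⇒≤ (toℕ<n y)))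

  x⊕y⊖y≡x : ∀ x y → x ⊕ y ⊖ y ≡ x
  x⊕y⊖y≡x x y = ⊹-inverse x (m+[n∸m]≡n (<⇒≤ (toℕ<n y)))

  ⊕-comm : ∀ x y → x ⊕ y ≡ y ⊕ x
  ⊕-comm x y = cong (_mod v) (+-comm (toℕ x) (toℕ y))

  ⊕-cancelˡ : ∀ x {y z} → x ⊕ y ≡ x ⊕ z → y ≡ z
  ⊕-cancelˡ x {y} {z} x⊕y≡x⊕z = begin
    y          ≡⟨ x⊕y⊖y≡x y x ⟨
    y ⊕ x ⊖ x  ≡⟨ cong (_⊖ x) (trans (⊕-comm y x) (trans x⊕y≡x⊕z (⊕-comm x z))) ⟩
    z ⊕ x ⊖ x  ≡⟨ x⊕y⊖y≡x z x ⟩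
    z          ∎
    where open ≡-Reasoning

module Construction (v : ℕ) .{{_ : NonZero v}} (m : ℕ) (m≤v : m ≤ v) where

  Row : Set
  Row = Fin m × Fin v × Fin v

  infixl 6 _⊞_ _⊟_

  _⊞_ _⊟_ : Fin v → Fin m → Fin v
  x ⊞ s = x ⊕ inject≤ s m≤v
  x ⊟ s = x ⊖ inject≤ s m≤v

  ⊟-⊞ : ∀ x s → x ⊟ s ⊞ s ≡ x
  ⊟-⊞ x s = x⊖y⊕y≡x x (inject≤ s m≤v)

  -- The bound `m ≤ v` makes the `m` shifts distinct residues modulo `v`, so a value together with
  -- its shifted copy reveals `s`.
  ⊞-cancel : ∀ {x x′ s s′} → x ≡ x′ → x ⊞ s ≡ x′ ⊞ s′ → s ≡ s′
  ⊞-cancel {x} {s = s} {s′} refl eq =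
    inject≤-injective m≤v m≤v s s′ (⊕-cancelˡ x eq)

  entry : Row → Fin 5 → Fin v
  entry (s , a , b) 0F = a
  entry (s , a , b) 1F = b
  entry (s , a , b) 2F = a ⊞ s
  entry (s , a , b) 3F = b ⊞ s
  entry (s , a , b) 4F = a

  -- The nesting follows the unfolding of `v ^ 2` as `v * (v * 1)`; the final `zero` is the sole
  -- element of `Fin (v ^ 0)`.
  encode : Row → Fin (m * v ^ 2)
  encode (s , a , b) = combine s (combine a (combine b zero))

  decodeLast : Fin (v ^ 1) → Fin v
  decodeLast r = proj₁ (remQuot (v ^ 0) r)

  decodePair : Fin (v ^ 2) → Fin v × Fin v
  decodePair r = map₂ decodeLast (remQuot (v ^ 1) r)

  decode : Fin (m * v ^ 2) → Row
  decode r = map₂ decodePair (remQuot (v ^ 2) r)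

  decode-encode : ∀ r → decode (encode r) ≡ r
  decode-encode (s , a , b) = begin
    decode (encode (s , a , b))                    ≡⟨ cong (map₂ decodePair) (remQuot-combine s _) ⟩
    (s , decodePair (combine a (combine b zero)))  ≡⟨ cong (λ p → s , map₂ decodeLast p) (remQuot-combine a _) ⟩
    (s , a , decodeLast (combine b zero))          ≡⟨ cong (λ p → s , a , proj₁ p) (remQuot-combine {v} {1} b zero) ⟩
    (s , a , b)                                    ∎
    where open ≡-Reasoning

  array : Array (m * v ^ 2) 5 v
  array r = entry (decode r)

  Agree : Row → Row → Interaction 2 5 v → Set
  Agree r r′ T = ∀ j → entry r (column T j) ≡ entry r′ (column T j)

  -- Leaves 0 to 3 as the only starts. As the bound of an interaction is irrelevant, this refutation
  -- is applied through `⊥-elim-irr`.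
  4≰start : ∀ i → ¬ 4 + i + 2 ≤ 5
  4≰start i (s≤s (s≤s (s≤s (s≤s i+2≤1)))) rewrite +-comm i 2 = case i+2≤1 of λ { (s≤s ()) }

  -- Two different starts always reach both columns of one of the pairs (0, 2), (1, 3), (2, 4), and
  -- each such pair holds the same coordinate once plain and once shifted by `s`.
  agree⇒≡ : ∀ {r r′} T T′ → start T < start T′ →
    Agree r r′ T → Agree r r′ T′ → proj₁ r ≡ proj₁ r′
  agree⇒≡ (interaction 0 _ _) (interaction 1 _ _) _ p q = ⊞-cancel (p 0F) (q 1F)
  agree⇒≡ (interaction 0 _ _) (interaction 2 _ _) _ p q = ⊞-cancel (p 0F) (q 0F)
  agree⇒≡ (interaction 0 _ _) (interaction 3 _ _) _ p q = ⊞-cancel (p 1F) (q 0F)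
  agree⇒≡ (interaction 1 _ _) (interaction 2 _ _) _ p q = ⊞-cancel (p 0F) (q 1F)
  agree⇒≡ (interaction 1 _ _) (interaction 3 _ _) _ p q = ⊞-cancel (p 0F) (q 0F)
  -- Here the later interaction supplies the plain value: column 4 repeats `a`, while column 2 holds
  -- `a ⊞ s`.
  agree⇒≡ (interaction 2 _ _) (interaction 3 _ _) _ p q = ⊞-cancel (q 1F) (p 0F)
  agree⇒≡ _ (interaction (suc (suc (suc (suc i)))) bound _) _ _ _ = ⊥-elim-irr (4≰start i bound)
  agree⇒≡ (interaction (suc (suc (suc _))) _ _) (interaction 3 _ _) (s≤s (s≤s (s≤s ()))) _ _
  agree⇒≡ (interaction (suc (suc _)) _ _) (interaction 2 _ _) (s≤s (s≤s ())) _ _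
  agree⇒≡ (interaction (suc _) _ _) (interaction 1 _ _) (s≤s ()) _ _

  -- For fixed `s` the two prescribed entries determine `a` and `b`: an entry in column 2 or 3 is
  -- shifted back by `s`, any other is taken as it is.
  rowOf : Interaction 2 5 v → Fin m → Row
  rowOf (interaction 0 _ (x ∷ y ∷ [])) s = s , x , y
  rowOf (interaction 1 _ (x ∷ y ∷ [])) s = s , y ⊟ s , x
  rowOf (interaction 2 _ (x ∷ y ∷ [])) s = s , x ⊟ s , y ⊟ s
  rowOf (interaction 3 _ (x ∷ y ∷ [])) s = s , y , x ⊟ s
  rowOf (interaction (suc (suc (suc (suc i)))) bound _) s = ⊥-elim-irr (4≰start i bound)

  proj₁-rowOf : ∀ T s → proj₁ (rowOf T s) ≡ s
  proj₁-rowOf (interaction 0 _ (x ∷ y ∷ [])) s = refl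
  proj₁-rowOf (interaction 1 _ (x ∷ y ∷ [])) s = refl
  proj₁-rowOf (interaction 2 _ (x ∷ y ∷ [])) s = refl
  proj₁-rowOf (interaction 3 _ (x ∷ y ∷ [])) s = refl
  proj₁-rowOf (interaction (suc (suc (suc (suc i)))) bound _) s = ⊥-elim-irr (4≰start i bound)

  entry-rowOf : ∀ T s j → entry (rowOf T s) (column T j) ≡ lookupᵛ (values T) j
  entry-rowOf (interaction 0 _ (x ∷ y ∷ [])) s 0F = refl
  entry-rowOf (interaction 0 _ (x ∷ y ∷ [])) s 1F = refl
  entry-rowOf (interaction 1 _ (x ∷ y ∷ [])) s 0F = refl
  entry-rowOf (interaction 1 _ (x ∷ y ∷ [])) s 1F = ⊟-⊞ y s
  entry-rowOf (interaction 2 _ (x ∷ y ∷ [])) s 0F = ⊟-⊞ x s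
  entry-rowOf (interaction 2 _ (x ∷ y ∷ [])) s 1F = ⊟-⊞ y s
  entry-rowOf (interaction 3 _ (x ∷ y ∷ [])) s 0F = ⊟-⊞ x s
  entry-rowOf (interaction 3 _ (x ∷ y ∷ [])) s 1F = refl
  entry-rowOf (interaction (suc (suc (suc (suc i)))) bound _) s _ = ⊥-elim-irr (4≰start i bound)

  row : Interaction 2 5 v → Fin m → Fin (m * v ^ 2)
  row T s = encode (rowOf T s)

  decode-row : ∀ T s → proj₁ (decode (row T s)) ≡ s
  decode-row T s = trans (cong proj₁ (decode-encode (rowOf T s))) (proj₁-rowOf T s)

  row∈ρ : ∀ T s → row T s ∈ ρ array T
  row∈ρ T s j =
    trans (cong (λ r → entry r (column T j)) (decode-encode (rowOf T s))) (entry-rowOf T s j)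

  ρ-agree : ∀ T {r r′} → r ∈ ρ array T → r′ ∈ ρ array T → Agree (decode r) (decode r′) T
  ρ-agree T r∈T r′∈T j = trans (r∈T j) (sym (r′∈T j))

  row-separated : ∀ T T′ s s′ → T ≢ T′ →
    row T s ∈ ρ array T′ → row T s′ ∈ ρ array T′ → s ≡ s′
  row-separated T T′ s s′ T≢T′ p p′ = begin
    s                             ≡⟨ decode-row T s ⟨
    proj₁ (decode (row T s))      ≡⟨ same ⟩
    proj₁ (decode (row T s′))     ≡⟨ decode-row T s′ ⟩
    s′                            ∎
    where
    open ≡-Reasoning
    agreeT  = ρ-agree T {row T s} {row T s′} (row∈ρ T s) (row∈ρ T s′)
    agreeT′ = ρ-agree T′ {row T s} {row T s′} p p′
    same : proj₁ (decode (row T s)) ≡ proj₁ (decode (row T s′))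
    same with <-cmp (start T) (start T′)
    ... | tri< lt _ _ = agree⇒≡ T T′ lt agreeT agreeT′
    ... | tri> _ _ gt = agree⇒≡ T′ T gt agreeT′ agreeT
    ... | tri≈ _ eq _ =
      -- With equal starts, the row `row T s` lies in both interactions, which would make them
      -- equal.
      contradiction (ρ-start-determines array T T′ {row T s} eq (row∈ρ T s) p) T≢T′

mainTheorem19 : (v : ℕ) → 2 ≤ v → (d : ℕ) → 1 ≤ d → d + 1 ≤ v →
    ¬ PossibleException d v →
    Σ[ A ∈ Array ((d + 1) * v ^ 2) 5 v ] IsOptimumCDA d 2 A
mainTheorem19 v 2≤v d _ d+1≤v _ = array , record
  { isCDA   = separated⇒IsCDA array row row∈ρ row-separated
  -- Taking `m` to be `d + 1` makes the number of rows `(d + 1) * v ^ 2` by definition.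
  ; optimum = refl
  }
  where
  instance v≢0 = >-nonZero (≤-trans (s≤s z≤n) 2≤v)
  open Construction v (d + 1) d+1≤v
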